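{- For every integer $n > 2$, the tensor product graph $P_n \wedge P_4$ is odd graceful.
   Context: All graphs are finite and simple. $P_n$ denotes the path graph on $n$ vertices. The tensor product $G_1 \wedge G_2$ of two graphs $G_1, G_2$ is the graph with vertex set $V(G_1) \times V(G_2)$ in which $(u_1,v_1)$ and $(u_2,v_2)$ are adjacent if and only if $u_1u_2 \in E(G_1)$ and $v_1v_2 \in E(G_2)$. An odd graceful labeling of a graph $G$ with $q = |E(G)|$ edges is a one-to-one function $f : V(G) \to \{0,1,2,\ldots,2q-1\}$ such that, when each edge $uv$ is given the label $f^*(uv) = |f(u)-f(v)|$, the resulting set of edge labels is exactly $\{1,3,5,\ldots,2q-1\}$ (so the $q$ edge labels are distinct). A graph is odd graceful if it has an odd graceful labeling. -}

module Defs where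

open import Data.Fin.Base as Fin using (Fin; toℕ)
open import Data.Fin.Properties as Fin using (*↔×)
open import Data.List.Base using (List; allFin; cartesianProduct; filter; length; map)
open import Data.Nat.Base using (ℕ; suc; _*_; _+_; _<_; ∣_-_∣)
open import Data.Nat.Properties as ℕ using (1+n≢n)
open import Data.Product.Base using (_×_; _,_; ∃; ∃-syntax)
import Data.Product.Base as Product
open import Data.Product.Function.NonDependent.Propositional using (_×-↔_)
open import Data.Sum.Base using (_⊎_; [_,_]′; swap)
open import Function.Bundles using (Inverse; _↔_; _⇔_)
open import Function.Construct.Identity using (↔-id)
open import Function.Definitions using (Injective)
open import Function.Properties.Inverse using (↔-sym; ↔-trans)
open import Level using (0ℓ)
open import Relation.Binary.Core using (Rel)
open import Relation.Binary.Definitions using (Decidable; Symmetric)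
open import Relation.Binary.PropositionalEquality.Core using (_≡_)
open import Relation.Nullary.Decidable using (_×-dec_; _⊎-dec_)
open import Relation.Nullary.Negation using (¬_)

record Graph : Set₁ where
  field
    V        : Set
    order    : ℕ
    finite   : V ↔ Fin order
    Adj      : Rel V 0ℓ
    adj?     : Decidable Adj
    adj-sym  : Symmetric Adj
    loopless : ∀ {v} → ¬ Adj v v

  index : V → Fin order
  index = Inverse.to finite

  vertices : List V
  vertices = map (Inverse.from finite) (allFin order)

  -- Each undirected edge is listed once, with its lower-indexed endpoint first.
  edges : List (V × V)
  edges = filter (λ (u , v) → index u Fin.<? index v ×-dec adj? u v)
                 (cartesianProduct vertices vertices)

  size : ℕ
  size = length edges

P : ℕ → Graph
P n = record
  { V        = Fin n
  ; order    = n
  ; finite   = ↔-id (Fin n)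
  ; Adj      = λ i j → suc (toℕ i) ≡ toℕ j ⊎ suc (toℕ j) ≡ toℕ i
  ; adj?     = λ i j → suc (toℕ i) ℕ.≟ toℕ j ⊎-dec suc (toℕ j) ℕ.≟ toℕ i
  ; adj-sym  = swap
  ; loopless = [ 1+n≢n , 1+n≢n ]′
  }

infixr 6 _∧_

_∧_ : Graph → Graph → Graph
G ∧ H = record
  { V        = G.V × H.V
  ; order    = G.order * H.order
  ; finite   = ↔-trans (G.finite ×-↔ H.finite) (↔-sym *↔×)
  ; Adj      = λ (u₁ , v₁) (u₂ , v₂) → G.Adj u₁ u₂ × H.Adj v₁ v₂
  ; adj?     = λ (u₁ , v₁) (u₂ , v₂) → G.adj? u₁ u₂ ×-dec H.adj? v₁ v₂
  ; adj-sym  = Product.map G.adj-sym H.adj-sym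
  ; loopless = λ (e , _) → G.loopless e
  }
  where
  module G = Graph G
  module H = Graph H

module _ (G : Graph) where
  open Graph G

  record IsOddGracefulLabeling (f : V → Fin (2 * size)) : Set where
    field
      injective : Injective _≡_ _≡_ f
      -- The set of edge labels is exactly {1, 3, …, 2q − 1}, where q = size.
      labels    : ∀ k → (∃[ u ] ∃[ v ] Adj u v × k ≡ ∣ toℕ (f u) - toℕ (f v) ∣)
                        ⇔ (∃[ i ] i < size × k ≡ 2 * i + 1)

  OddGraceful : Set
  OddGraceful = ∃ IsOddGracefulLabeling

{-# OPTIONS --safe #-}

-- Let q = 6m be the number of edges, where n = m + 1. Give the vertex (i , j) a
-- height: 1, 2, 0, 3 along row 0, then 3, 0, 1, 2 along row 1, and 6 more than
-- two rows above from there on. The six edges between rows 0 and 1 have height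
-- sums 0, …, 5, and passing to the next pair of rows adds 6 to these sums, so
-- the edges of the graph have height sums 0, …, q − 1, each once. An even row
-- with heights x gets the even labels 2x, an odd row with heights y the odd labels
-- 2q − 1 − 2y; the edge with height sum k is then labelled 2(q − 1 − k) + 1.
module Submission where

open import Data.Fin.Base as Fin
  using (Fin; suc; toℕ; fromℕ<; inject₁; opposite; remQuot; combine)
open import Data.Fin.Patterns using (0F; 1F; 2F; 3F)
open import Data.Fin.Properties as Fin
  using (all?; any?; toℕ<n; toℕ-fromℕ<; toℕ-injective; toℕ-inject₁;
         toℕ-combine; combine-remQuot; remQuot-combine; combine-monoˡ-<; opposite-prop; opposite-involutive)
open import Data.List.Base using (allFin; cartesianProduct; tabulate)
open import Data.List.Membership.Propositional using (_∈_)
open import Data.List.Membership.Propositional.Properties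
  using (∈-filter⁺; ∈-filter⁻; ∈-cartesianProduct⁺; ∈-map⁺; ∈-allFin; ∈-tabulate⁺; ∈-tabulate⁻)
open import Data.List.Membership.Propositional.Properties.WithK using (unique∧set⇒bag)
open import Data.List.Properties using (length-tabulate)
open import Data.List.Relation.Binary.BagAndSetEquality using (∼bag⇒↭)
open import Data.List.Relation.Binary.Permutation.Propositional.Properties using (↭-length)
import Data.List.Relation.Unary.Unique.Propositional.Properties as Unique
open import Data.Nat.Base
open import Data.Nat.Properties
open import Data.Nat.Solver using (module +-*-Solver)
open import Data.Parity.Base using (Parity; 0ℙ; 1ℙ)
open import Data.Product.Base using (_×_; _,_; proj₁; proj₂; ∃-syntax; swap; uncurry)
open import Data.Product.Properties using (≡-dec)
open import Data.Sum.Base using (inj₁; inj₂)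
open import Data.Vec.Base using (lookup; []; _∷_)
open import Defs
open import Function.Base using (_∘_)
open import Function.Bundles using (Inverse; mk⇔)
open import Function.Definitions using (Injective)
open import Relation.Binary.Definitions using (tri<; tri≈; tri>)
open import Relation.Binary.PropositionalEquality
open import Relation.Nullary.Decidable using (Dec; from-yes; _×-dec_; _→-dec_)
open import Relation.Nullary.Negation using (contradiction)

-- Odd gracefulness from an indexed enumeration of the edges.

module _ (G : Graph) where
  open Graph G

  index-injective : Injective _≡_ _≡_ index
  index-injective {u} {v} eq = begin
    u                             ≡⟨ Inverse.strictlyInverseʳ finite u ⟨
    Inverse.from finite (index u) ≡⟨ cong (Inverse.from finite) eq ⟩
    Inverse.from finite (index v) ≡⟨ Inverse.strictlyInverseʳ finite v ⟩
    v                             ∎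
    where open ≡-Reasoning

  ∈-vertices : ∀ v → v ∈ vertices
  ∈-vertices v = subst (_∈ vertices) (Inverse.strictlyInverseʳ finite v)
    (∈-map⁺ (Inverse.from finite) (∈-allFin (index v)))

  Ordered : V × V → Set
  Ordered (u , v) = index u Fin.< index v × Adj u v

  ordered? : ∀ e → Dec (Ordered e)
  ordered? (u , v) = index u Fin.<? index v ×-dec adj? u v

  module EdgeEnumeration
    {q : ℕ} (edge : Fin q → V × V)
    (edge-ordered    : ∀ k → Ordered (edge k))
    (edge-surjective : ∀ {e} → Ordered e → ∃[ k ] edge k ≡ e)
    where

    -- `edges` and `tabulate edge` are duplicate-free lists with the same members, so each is a
    -- permutation of the other.
    size≡ : Injective _≡_ _≡_ edge → size ≡ q
    size≡ edge-injective = trans (↭-length (∼bag⇒↭ (unique∧set⇒bag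
        (Unique.filter⁺ ordered? (Unique.cartesianProduct⁺ vertices-unique vertices-unique))
        (Unique.tabulate⁺ edge-injective)
        (mk⇔ to from))))
      (length-tabulate edge)
      where
      vertices-unique = Unique.map⁺ from-injective (Unique.allFin⁺ order)
        where
        from-injective : Injective _≡_ _≡_ (Inverse.from finite)
        from-injective {i} {j} eq = trans (sym (Inverse.strictlyInverseˡ finite i))
          (trans (cong index eq) (Inverse.strictlyInverseˡ finite j))

      to : ∀ {e} → e ∈ edges → e ∈ tabulate edge
      to {e} e∈ with edge-surjective {e} (proj₂ (∈-filter⁻ ordered? {xs = cartesianProduct vertices vertices} e∈))
      ... | k , refl = ∈-tabulate⁺ k

      from : ∀ {e} → e ∈ tabulate edge → e ∈ edges
      from e∈ with ∈-tabulate⁻ e∈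
      ... | k , refl = ∈-filter⁺ ordered?
        (∈-cartesianProduct⁺ (∈-vertices _) (∈-vertices _)) (edge-ordered k)

    module _
      (label : V → ℕ) (label-injective : Injective _≡_ _≡_ label)
      (label< : ∀ v → label v < 2 * q)
      (edge-label : ∀ k → ∣ label (proj₁ (edge k)) - label (proj₂ (edge k)) ∣ ≡ 2 * toℕ k + 1)
      where

      -- An edge's label `2 * toℕ k + 1` determines `k`; this is what makes `size≡` applicable.
      edge-injective : Injective _≡_ _≡_ edge
      edge-injective {k} {l} eq = toℕ-injective (*-cancelˡ-≡ _ _ 2 (+-cancelʳ-≡ 1 _ _ (begin
        2 * toℕ k + 1                                       ≡⟨ edge-label k ⟨
        ∣ label (proj₁ (edge k)) - label (proj₂ (edge k)) ∣ ≡⟨ cong (λ (u , v) → ∣ label u - label v ∣) eq ⟩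
        ∣ label (proj₁ (edge l)) - label (proj₂ (edge l)) ∣ ≡⟨ edge-label l ⟩
        2 * toℕ l + 1                                       ∎)))
        where open ≡-Reasoning

      private
        s≡q = size≡ edge-injective

      f : V → Fin (2 * size)
      -- Only the bound is transported along `s≡q`, so the value stays `label v`.
      f v = fromℕ< (subst (λ s → label v < 2 * s) (sym s≡q) (label< v))

      toℕ-f : ∀ v → toℕ (f v) ≡ label v
      toℕ-f v = toℕ-fromℕ< _

      ordered-label : ∀ {u v} → Ordered (u , v) →
        ∃[ i ] i < size × ∣ toℕ (f u) - toℕ (f v) ∣ ≡ 2 * i + 1
      ordered-label {u} {v} uv with edge-surjective uv
      ... | k , refl = toℕ k , subst (toℕ k <_) (sym s≡q) (toℕ<n k) ,
        trans (cong₂ ∣_-_∣ (toℕ-f u) (toℕ-f v)) (edge-label k)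

      adjacent-label : ∀ {u v} → Adj u v →
        ∃[ i ] i < size × ∣ toℕ (f u) - toℕ (f v) ∣ ≡ 2 * i + 1
      adjacent-label {u} {v} uv with Fin.<-cmp (index u) (index v)
      ... | tri< u<v _ _ = ordered-label (u<v , uv)
      ... | tri≈ _ u≡v _ with refl ← index-injective u≡v = contradiction uv loopless
      ... | tri> _ _ v<u with i , i< , eq ← ordered-label (v<u , adj-sym uv) =
        i , i< , trans (∣-∣-comm (toℕ (f u)) (toℕ (f v))) eq

      oddGraceful : OddGraceful G
      oddGraceful = f , record
        { injective = λ {u} {v} eq →
            label-injective (trans (sym (toℕ-f u)) (trans (cong toℕ eq) (toℕ-f v)))
        ; labels = λ k → mk⇔
            (λ { (u , v , uv , refl) → adjacent-label uv })
            (λ { (i , i< , refl) → realised i (subst (i <_) s≡q i<) })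
        }
        where
        realised : ∀ i → i < q → ∃[ u ] ∃[ v ] Adj u v × 2 * i + 1 ≡ ∣ toℕ (f u) - toℕ (f v) ∣
        realised i i<q = _ , _ , proj₂ (edge-ordered k) , sym (begin
          _             ≡⟨ cong₂ ∣_-_∣ (toℕ-f _) (toℕ-f _) ⟩
          _             ≡⟨ edge-label k ⟩
          2 * toℕ k + 1 ≡⟨ cong (λ i → 2 * i + 1) (toℕ-fromℕ< i<q) ⟩
          2 * i + 1     ∎)
          where
          open ≡-Reasoning
          k = fromℕ< i<q

-- Heights of the rows and sums along edges.

height : ℕ → Fin 4 → ℕ
height 0             = lookup (1 ∷ 2 ∷ 0 ∷ 3 ∷ [])
height 1             = lookup (3 ∷ 0 ∷ 1 ∷ 2 ∷ [])
height (suc (suc i)) = λ j → 6 + height i j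

-- The columns of the edge with height sum 6 i + t, which joins rows i and i + 1.
columns : ℕ → Fin 6 → Fin 4 × Fin 4
columns zero    = lookup ((2F , 1F) ∷ (0F , 1F) ∷ (2F , 3F) ∷ (1F , 2F) ∷ (3F , 2F) ∷ (1F , 0F) ∷ [])
columns (suc i) = swap ∘ columns i

columns-adjacent : ∀ i t → uncurry (Graph.Adj (P 4)) (columns i t)
columns-adjacent zero    =
  from-yes (all? λ t → Graph.adj? (P 4) (proj₁ (columns 0 t)) (proj₂ (columns 0 t)))
columns-adjacent (suc i) t = Graph.adj-sym (P 4) (columns-adjacent i t)

columns-surjective : ∀ i j j′ → Graph.Adj (P 4) j j′ → ∃[ t ] columns i t ≡ (j , j′)
columns-surjective zero    = from-yes (all? λ j → all? λ j′ →
  Graph.adj? (P 4) j j′ →-dec any? λ t → ≡-dec Fin._≟_ Fin._≟_ (columns 0 t) (j , j′))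
columns-surjective (suc i) j j′ jj′
  with t , eq ← columns-surjective i j′ j (Graph.adj-sym (P 4) {j} {j′} jj′) = t , cong swap eq

-- Row `i + 2` is row `i` raised by 6. Moving the row-`i` end of an edge up two rows therefore adds
-- 6 to its sum and swaps its columns, as in `columns`.
height-sum : ∀ i t → height i (proj₁ (columns i t)) + height (suc i) (proj₂ (columns i t))
                     ≡ 6 * i + toℕ t
height-sum zero    = from-yes (all? λ t →
  height 0 (proj₁ (columns 0 t)) + height 1 (proj₂ (columns 0 t)) ≟ toℕ t)
height-sum (suc i) t = begin
  y + (6 + x)           ≡⟨ solve 2 (λ x y → y :+ (con 6 :+ x) := con 6 :+ (x :+ y)) refl x y ⟩
  6 + (x + y)           ≡⟨ cong (6 +_) (height-sum i t) ⟩
  6 + (6 * i + toℕ t)   ≡⟨ +-assoc 6 (6 * i) (toℕ t) ⟨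
  6 + 6 * i + toℕ t     ≡⟨ cong (_+ toℕ t) (*-suc 6 i) ⟨
  6 * suc i + toℕ t     ∎
  where
  open ≡-Reasoning
  open +-*-Solver
  x = height i (proj₁ (columns i t))
  y = height (suc i) (proj₂ (columns i t))

height₀<6 : ∀ j → height 0 j < 6
height₀<6 = from-yes (all? λ j → height 0 j <? 6)

height₁<6 : ∀ j → height 1 j < 6
height₁<6 = from-yes (all? λ j → height 1 j <? 6)

height< : ∀ m i j → i ≤ suc m → height i j < suc m * 6
height< m       0             j _ = <-≤-trans (height₀<6 j) (m≤m+n 6 (m * 6))
height< m       1             j _ = <-≤-trans (height₁<6 j) (m≤m+n 6 (m * 6))
height< (suc m) (suc (suc i)) j (s≤s (s≤s i≤m)) =
  -- Two rows fewer cost a single block of 6, so `m` drops only by one and `i ≤ m` is weakened.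
  +-monoʳ-< 6 (height< m i j (m≤n⇒m≤1+n i≤m))

-- Rows 0 and 1 each have distinct heights below 6. Within one parity class, the height modulo 6
-- thus gives the column and the quotient gives the row. Rows of opposite parity can share heights.
height-injective : ∀ i i′ {j j′} → parity i ≡ parity i′ → height i j ≡ height i′ j′ →
                   i ≡ i′ × j ≡ j′
height-injective 0 0 {j} {j′} _ eq = refl ,
  from-yes (all? λ j → all? λ j′ → height 0 j ≟ height 0 j′ →-dec j Fin.≟ j′) j j′ eq
height-injective 1 1 {j} {j′} _ eq = refl ,
  from-yes (all? λ j → all? λ j′ → height 1 j ≟ height 1 j′ →-dec j Fin.≟ j′) j j′ eq
height-injective 0 (suc (suc i′)) {j} _ eq =
  contradiction (subst (_< 6) eq (height₀<6 j)) (m+n≮m 6 _)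
height-injective 1 (suc (suc i′)) {j} _ eq =
  contradiction (subst (_< 6) eq (height₁<6 j)) (m+n≮m 6 _)
height-injective (suc (suc i)) 0 {j′ = j′} _ eq =
  contradiction (subst (_< 6) (sym eq) (height₀<6 j′)) (m+n≮m 6 _)
height-injective (suc (suc i)) 1 {j′ = j′} _ eq =
  contradiction (subst (_< 6) (sym eq) (height₁<6 j′)) (m+n≮m 6 _)
height-injective (suc (suc i)) (suc (suc i′)) p eq
  with refl , j≡j′ ← height-injective i i′ p (+-cancelˡ-≡ 6 _ _ eq) = refl , j≡j′

-- From heights to labels.

place : ℕ → Parity → ℕ → ℕ
place q 0ℙ x = 2 * x
place q 1ℙ y = suc (2 * (q ∸ suc y))

place< : ∀ {q} p {x} → x < q → place q p x < 2 * q
place<         0ℙ     x<q = *-monoʳ-< 2 x<q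
place< {suc q} 1ℙ {y} y<q = subst (suc (suc (2 * (q ∸ y))) ≤_) (sym (*-suc 2 q))
  (s≤s (s≤s (*-monoʳ-≤ 2 (m∸n≤m q y))))

-- The parity of the value recovers `p`. For odd values, the bounds by `q` keep the truncated
-- subtraction cancellable.
place-injective : ∀ {q} p p′ {x x′} → x < q → x′ < q → place q p x ≡ place q p′ x′ →
                  p ≡ p′ × x ≡ x′
place-injective     0ℙ 0ℙ          x< x′< eq = refl , *-cancelˡ-≡ _ _ 2 eq
place-injective     1ℙ 1ℙ          x< x′< eq =
  refl , suc-injective (∸-cancelˡ-≡ x< x′< (*-cancelˡ-≡ _ _ 2 (suc-injective eq)))
place-injective {q} 0ℙ 1ℙ {x} {x′} x< x′< eq =
  contradiction eq (even≢odd x (q ∸ suc x′))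
place-injective {q} 1ℙ 0ℙ {x} {x′} x< x′< eq =
  contradiction (sym eq) (even≢odd x′ (q ∸ suc x))

-- Here `z` is `q − 1 − (x + y)`. Writing `q` as a sum turns `q ∸ suc y` into `x + z`, so the odd
-- label exceeds `2 * x` by `2 * z + 1`.
place-difference : ∀ i x y z →
  let q = x + y + suc z in
  ∣ place q (parity i) x - place q (parity (suc i)) y ∣ ≡ 2 * z + 1
place-difference 0 x y z = begin
  ∣ 2 * x - suc (2 * (x + y + suc z ∸ suc y)) ∣ ≡⟨ cong (λ w → ∣ 2 * x - suc (2 * w) ∣) q∸sy ⟩
  ∣ 2 * x - suc (2 * (x + z)) ∣                 ≡⟨ cong (∣ 2 * x -_∣) (expand x z) ⟩
  ∣ 2 * x - 2 * x + (2 * z + 1) ∣               ≡⟨ ∣m-m+n∣≡n (2 * x) (2 * z + 1) ⟩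
  2 * z + 1                                     ∎
  where
  open ≡-Reasoning
  open +-*-Solver
  expand = solve 2 (λ x z → con 1 :+ con 2 :* (x :+ z) := con 2 :* x :+ (con 2 :* z :+ con 1)) refl
  q∸sy : x + y + suc z ∸ suc y ≡ x + z
  q∸sy = trans
    (cong (_∸ suc y)
      (solve 3 (λ x y z → x :+ y :+ (con 1 :+ z) := con 1 :+ y :+ (x :+ z)) refl x y z))
    (m+n∸m≡n (suc y) (x + z))
-- Now `y` has the even label: exchanging the endpoints, also inside `q`, leads back to the previous
-- case.
place-difference 1 x y z = begin
  ∣ place q 1ℙ x - place q 0ℙ y ∣ ≡⟨ ∣-∣-comm (place q 1ℙ x) (place q 0ℙ y) ⟩
  ∣ place q 0ℙ y - place q 1ℙ x ∣ ≡⟨ cong (λ w → ∣ place (w + suc z) 0ℙ y - place (w + suc z) 1ℙ x ∣) (+-comm x y) ⟩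
  _                               ≡⟨ place-difference 0 y x z ⟩
  2 * z + 1                       ∎
  where
  open ≡-Reasoning
  q = x + y + suc z
place-difference (suc (suc i)) = place-difference i

-- The labeling of the tensor product.

module _ (m : ℕ) where
  private
    -- This `m` is one less than in the overview: `suc m` pairs of consecutive rows carry six edges
    -- each.
    G = P (2 + m) ∧ P 4
    q = suc m * 6
  open Graph G

  edge′ : Fin (suc m) → Fin 6 → V × V
  edge′ r t = (inject₁ r , proj₁ (columns (toℕ r) t)) , (suc r , proj₂ (columns (toℕ r) t))

  -- With `k = 6 r + t`, this is the edge of height sum `k`.
  edge : Fin q → V × V
  edge k = uncurry edge′ (remQuot 6 k)

  edge′-ordered : ∀ r t → Ordered G (edge′ r t)
  edge′-ordered r t =
    -- Indices in the product are lexicographic, so the lower row comes first.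
    combine-monoˡ-< _ _ (s≤s (≤-reflexive (toℕ-inject₁ r))) ,
    inj₁ (cong suc (toℕ-inject₁ r)) , columns-adjacent (toℕ r) t

  edge-ordered : ∀ k → Ordered G (edge k)
  edge-ordered k = uncurry edge′-ordered (remQuot 6 k)

  edge-surjective : ∀ {e} → Ordered G e → ∃[ k ] edge k ≡ e
  edge-surjective {(i , j) , (suc r , j′)} (_ , inj₁ i+1≡ , jj′)
    with refl ← toℕ-injective {i = i} {j = inject₁ r} (trans (suc-injective i+1≡) (sym (toℕ-inject₁ r)))
    with t , eq ← columns-surjective (toℕ r) j j′ jj′ =
      combine r t , trans (cong (uncurry edge′) (remQuot-combine r t))
        (cong (λ (j , j′) → (inject₁ r , j) , (suc r , j′)) eq)
  -- A second endpoint in the row below would have the smaller index.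
  edge-surjective {(i , j) , (i′ , j′)} (u<v , inj₂ i′+1≡ , _) =
    contradiction u<v (<-asym (combine-monoˡ-< {i = i′} {j = i} j′ j (≤-reflexive i′+1≡)))

  label : V → ℕ
  label (i , j) = place q (parity (toℕ i)) (height (toℕ i) j)

  height<q : ∀ i j → height (toℕ {2 + m} i) j < q
  height<q i j = height< m (toℕ i) j (s≤s⁻¹ (toℕ<n i))

  label< : ∀ v → label v < 2 * q
  label< (i , j) = place< (parity (toℕ i)) (height<q i j)

  label-injective : Injective _≡_ _≡_ label
  label-injective {i , j} {i′ , j′} eq
    with p≡ , h≡ ← place-injective (parity (toℕ i)) (parity (toℕ i′)) (height<q i j) (height<q i′ j′) eq
    with i≡ , j≡ ← height-injective (toℕ i) (toℕ i′) p≡ h≡ = cong₂ _,_ (toℕ-injective i≡) j≡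

  edge-label : ∀ k → ∣ label (proj₁ (edge k)) - label (proj₂ (edge k)) ∣ ≡ 2 * toℕ (opposite k) + 1
  edge-label k = begin
    ∣ place q (parity (toℕ (inject₁ r))) (height (toℕ (inject₁ r)) j) - L′ ∣
      ≡⟨ cong (λ i → ∣ place q (parity i) (height i j) - L′ ∣) (toℕ-inject₁ r) ⟩
    ∣ place q (parity i) x - place q (parity (suc i)) y ∣
      ≡⟨ cong (λ q → ∣ place q (parity i) x - place q (parity (suc i)) y ∣) q≡ ⟩
    _ ≡⟨ place-difference i x y (toℕ (opposite k)) ⟩
    2 * toℕ (opposite k) + 1 ∎
    where
    open ≡-Reasoning
    r = proj₁ (remQuot {suc m} 6 k)
    t = proj₂ (remQuot {suc m} 6 k)
    i = toℕ r
    j = proj₁ (columns i t)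
    x = height i j
    y = height (suc i) (proj₂ (columns i t))
    L′ = place q (parity (suc i)) y
    x+y≡k : x + y ≡ toℕ k
    x+y≡k = trans (height-sum i t)
      (trans (sym (toℕ-combine r t)) (cong toℕ (combine-remQuot {suc m} 6 k)))
    -- `opposite k` is `q − 1 − k`, the `z` of `place-difference`.
    q≡ : q ≡ x + y + suc (toℕ (opposite k))
    q≡ = sym (begin
      x + y + suc (toℕ (opposite k))     ≡⟨ cong₂ (λ a b → a + suc b) x+y≡k (opposite-prop k) ⟩
      toℕ k + suc (q ∸ suc (toℕ k))      ≡⟨ +-suc (toℕ k) _ ⟩
      suc (toℕ k) + (q ∸ suc (toℕ k))    ≡⟨ m+[n∸m]≡n (toℕ<n k) ⟩
      q                                  ∎)

  Pₙ∧P₄-oddGraceful : OddGraceful G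
  -- Labels decrease as height sums grow, so the enumeration is reversed to give the `k`-th edge the
  -- label `2 * k + 1`.
  Pₙ∧P₄-oddGraceful = EdgeEnumeration.oddGraceful G (edge ∘ opposite)
    (λ k → edge-ordered (opposite k))
    (λ e → let k , eq = edge-surjective e in
      opposite k , trans (cong edge (opposite-involutive k)) eq)
    label label-injective label<
    (λ k → trans (edge-label (opposite k)) (cong (λ k → 2 * toℕ k + 1) (opposite-involutive k)))

theorem3 : ∀ (n : ℕ) → n > 2 → OddGraceful (P n ∧ P 4)
theorem3 (suc (suc m)) _ = Pₙ∧P₄-oddGraceful m
theorem3 1 (s≤s ())
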